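{- For every integer $k\ge 2$ and every positive integer $n$, \[ t_{2k+1}(n)\le 9(k-1)\,\mathrm{ex}\!\left(\left\lceil \tfrac{n}{3}\right\rceil,\left\lceil \tfrac{n}{3}\right\rceil, C_{2k}\right). \]
   Context: All graphs are simple. For a graph $G$, $t(G)$ denotes the number of triangles ($K_3$ subgraphs) of $G$. A graph is $F$-free if it contains no (not necessarily induced) subgraph isomorphic to $F$. For $\ell\ge 3$, $t_\ell(n)$ is the maximum of $t(G)$ over all $C_\ell$-free graphs $G$ on $n$ vertices, where $C_\ell$ is the cycle of length $\ell$. $\mathrm{ex}(m,n,F)$ denotes the maximum number of edges in a bipartite graph with parts of sizes $m$ and $n$ that contains no subgraph isomorphic to $F$. -}

module Defs where

open import Level using (0ℓ)
open import Data.Bool.Base using (true; false)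
open import Data.Empty using (⊥)
open import Data.Nat.Base using (ℕ; zero; suc; _+_; _≤_; z≤n; s≤s)
open import Data.Nat.DivMod using (_/_)
import Data.Nat.Properties as ℕ
open import Data.Fin.Base as Fin using (Fin; zero; suc; toℕ)
import Data.Fin.Properties as Fin
open import Data.List.Base using (List; []; _∷_; _++_; map; filter; length; allFin; cartesianProduct)
open import Data.List.Extrema.Nat using (max; argmax-sel; v≤max⁺)
open import Data.List.Membership.Propositional using (_∈_; find; lose)
open import Data.List.Membership.Propositional.Properties
  using (∈-map⁺; ∈-map⁻; ∈-++⁺ˡ; ∈-++⁺ʳ; ∈-filter⁺; ∈-filter⁻; ∈-allFin; ∈-cartesianProduct⁺)
import Data.List.Membership.DecPropositional as DecMembership
open import Data.List.Properties using (filter-≐)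
open import Data.List.Relation.Unary.Any using (here)
import Data.List.Relation.Unary.Any as Any
open import Data.Product.Base using (∃; _×_; _,_; proj₁; proj₂)
open import Data.Product.Properties using (≡-dec)
open import Data.Sum.Base using (_⊎_; inj₁; inj₂; [_,_]′; swap)
import Data.Sum.Properties as Sum
import Data.Vec.Functional as Vector
open import Function.Base using (_∘_; id)
open import Function.Definitions using (Injective)
open import Relation.Binary.Core using (Rel)
open import Relation.Binary.Definitions using (Symmetric; Irreflexive; Decidable; DecidableEquality)
open import Relation.Binary.PropositionalEquality
  using (_≡_; _≢_; refl; sym; trans; cong; subst; subst₂; _≗_)
open import Relation.Nullary using (¬_; Dec; no; does)
open import Relation.Nullary.Decidable using (map′; ¬?; _×-dec_; _⊎-dec_; _→-dec_)
import Relation.Unary as U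

------------------------------------------------------------------------
-- Simple graphs

record Graph (V : Set) : Set₁ where
  field
    Adj    : Rel V 0ℓ
    symm   : Symmetric Adj
    irrefl : Irreflexive _≡_ Adj
    adj?   : Decidable Adj

open Graph public

-- A not necessarily induced copy of F in G.
record _⊑_ {U V : Set} (F : Graph U) (G : Graph V) : Set where
  field
    embed     : U → V
    injective : Injective _≡_ _≡_ embed
    preserves : ∀ {i j} → Adj F i j → Adj G (embed i) (embed j)

_-free_ : {U V : Set} → Graph U → Graph V → Set
F -free G = ¬ (F ⊑ G)

-- j is the successor of i modulo ℓ
Next : ∀ {ℓ} → Rel (Fin ℓ) 0ℓ
Next {ℓ} i j = toℕ j ≡ suc (toℕ i) ⊎ (suc (toℕ i) ≡ ℓ × toℕ j ≡ 0)

next? : ∀ {ℓ} → Decidable (Next {ℓ})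
next? {ℓ} i j = (toℕ j ℕ.≟ suc (toℕ i)) ⊎-dec ((suc (toℕ i) ℕ.≟ ℓ) ×-dec (toℕ j ℕ.≟ 0))

-- The condition i ≢ j only matters for ℓ = 1.
C : (ℓ : ℕ) → Graph (Fin ℓ)
C ℓ = record
  { Adj    = λ i j → i ≢ j × (Next i j ⊎ Next j i)
  ; symm   = λ (i≢j , e) → i≢j ∘ sym , swap e
  ; irrefl = λ i≡j (i≢j , _) → i≢j i≡j
  ; adj?   = λ i j → ¬? (i Fin.≟ j) ×-dec (next? i j ⊎-dec next? j i)
  }

-- Each K₃ subgraph is counted once, as its increasing triple of vertices.
Triangle : ∀ {n} → Graph (Fin n) → Fin n × Fin n × Fin n → Set
Triangle G (u , v , w) =
  (u Fin.< v × v Fin.< w) × (Adj G u v × Adj G v w × Adj G u w)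

triangle? : ∀ {n} (G : Graph (Fin n)) → U.Decidable (Triangle G)
triangle? G (u , v , w) =
  ((u Fin.<? v) ×-dec (v Fin.<? w)) ×-dec (adj? G u v ×-dec (adj? G v w ×-dec adj? G u w))

triangles : ∀ {n} → Graph (Fin n) → ℕ
triangles {n} G =
  length (filter (triangle? G) (cartesianProduct (allFin n) (cartesianProduct (allFin n) (allFin n))))

Bipartite : ∀ {m n} → Graph (Fin m ⊎ Fin n) → Set
Bipartite G = (∀ i i′ → ¬ Adj G (inj₁ i) (inj₁ i′)) × (∀ j j′ → ¬ Adj G (inj₂ j) (inj₂ j′))

Cross : ∀ {m n} → Graph (Fin m ⊎ Fin n) → Fin m × Fin n → Set
Cross G (i , j) = Adj G (inj₁ i) (inj₂ j)

cross? : ∀ {m n} (G : Graph (Fin m ⊎ Fin n)) → U.Decidable (Cross G)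
cross? G (i , j) = adj? G (inj₁ i) (inj₂ j)

-- The number of edges of G, provided that G is bipartite.
crossEdges : ∀ {m n} → Graph (Fin m ⊎ Fin n) → ℕ
crossEdges {m} {n} G = length (filter (cross? G) (cartesianProduct (allFin m) (allFin n)))

------------------------------------------------------------------------
-- Enumerating the graphs on a finite vertex set

record Finite (V : Set) : Set where
  field
    elements : List V
    complete : ∀ v → v ∈ elements
    _≟_      : DecidableEquality V

finiteFin : ∀ n → Finite (Fin n)
finiteFin n = record { elements = allFin n ; complete = ∈-allFin ; _≟_ = Fin._≟_ }

finite⊎ : ∀ m n → Finite (Fin m ⊎ Fin n)
finite⊎ m n = record
  { elements = map inj₁ (allFin m) ++ map inj₂ (allFin n)
  ; complete = λ where
      (inj₁ i) → ∈-++⁺ˡ (∈-map⁺ inj₁ (∈-allFin i))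
      (inj₂ j) → ∈-++⁺ʳ (map inj₁ (allFin m)) (∈-map⁺ inj₂ (∈-allFin j))
  ; _≟_ = Sum.≡-dec Fin._≟_ Fin._≟_
  }

sublists : {A : Set} → List A → List (List A)
sublists []       = [] ∷ []
sublists (x ∷ xs) = map (x ∷_) (sublists xs) ++ sublists xs

module _ {V : Set} (fin : Finite V) where
  open Finite fin
  open DecMembership (≡-dec _≟_ _≟_) using (_∈?_)

  fromPairs : List (V × V) → Graph V
  fromPairs es = record
    { Adj    = λ u v → u ≢ v × ((u , v) ∈ es ⊎ (v , u) ∈ es)
    ; symm   = λ (u≢v , e) → u≢v ∘ sym , swap e
    ; irrefl = λ u≡v (u≢v , _) → u≢v u≡v
    ; adj?   = λ u v → ¬? (u ≟ v) ×-dec (((u , v) ∈? es) ⊎-dec ((v , u) ∈? es))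
    }

  -- Every graph on V, up to equivalence of the adjacency relations (see
  -- graphs-complete), with repetitions.
  graphs : List (Graph V)
  graphs = map fromPairs (sublists (cartesianProduct elements elements))

  maximum : {P : Graph V → Set} → U.Decidable P → (Graph V → ℕ) → ℕ
  maximum P? f = max 0 (map f (filter P? graphs))

------------------------------------------------------------------------
-- Deciding F-freeness

anyFunction? : {V : Set} → Finite V → ∀ {ℓ} {P : (Fin ℓ → V) → Set} →
               (∀ {f g} → f ≗ g → P f → P g) → (∀ f → Dec (P f)) → Dec (∃ P)
anyFunction? fin {zero}  resp P? = map′ (λ p → Vector.[] , p) (λ (_ , p) → resp (λ ()) p) (P? Vector.[])
anyFunction? {V} fin {suc ℓ} {P} resp P? = map′ to from (Any.any? Q? elements)
  where
  open Finite fin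

  Q : V → Set
  Q v = ∃ λ (f : Fin ℓ → V) → P (v Vector.∷ f)

  Q? : U.Decidable Q
  Q? v = anyFunction? fin
    (λ f≗g → resp λ { zero → refl ; (suc i) → f≗g i }) (λ f → P? (v Vector.∷ f))

  to : Any.Any Q elements → ∃ P
  to a = let (v , _ , f , p) = find a in v Vector.∷ f , p

  from : ∃ P → Any.Any Q elements
  from (f , p) =
    lose (complete (f zero)) (f ∘ suc , resp (λ { zero → refl ; (suc _) → refl }) p)

module _ {V : Set} (fin : Finite V) {ℓ : ℕ} (F : Graph (Fin ℓ)) (G : Graph V) where
  open Finite fin

  private
    IsCopy : (Fin ℓ → V) → Set
    IsCopy f = (∀ i j → f i ≡ f j → i ≡ j) × (∀ i j → Adj F i j → Adj G (f i) (f j))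

    isCopy? : ∀ f → Dec (IsCopy f)
    isCopy? f = Fin.all? (λ i → Fin.all? λ j → (f i ≟ f j) →-dec (i Fin.≟ j))
          ×-dec Fin.all? (λ i → Fin.all? λ j → adj? F i j →-dec adj? G (f i) (f j))

    isCopy-resp : ∀ {f g} → f ≗ g → IsCopy f → IsCopy g
    isCopy-resp f≗g (inj , pres) =
      (λ i j gi≡gj → inj i j (trans (f≗g i) (trans gi≡gj (sym (f≗g j))))) ,
      (λ i j e → subst₂ (Adj G) (f≗g i) (f≗g j) (pres i j e))

  free? : Dec (F -free G)
  free? = ¬? (map′
    (λ (f , inj , pres) → record
      { embed = f ; injective = inj _ _ ; preserves = pres _ _ })
    (λ c → let open _⊑_ c in embed , (λ _ _ → injective) , (λ _ _ → preserves))
    (anyFunction? fin isCopy-resp isCopy?))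

bipartite? : ∀ {m n} → U.Decidable (Bipartite {m} {n})
bipartite? G =
        Fin.all? (λ i → Fin.all? λ i′ → ¬? (adj? G (inj₁ i) (inj₁ i′)))
  ×-dec Fin.all? (λ j → Fin.all? λ j′ → ¬? (adj? G (inj₂ j) (inj₂ j′)))

------------------------------------------------------------------------
-- The extremal functions

t : (ℓ n : ℕ) → ℕ
t ℓ n = maximum (finiteFin n) (free? (finiteFin n) (C ℓ)) triangles

ex : (m n : ℕ) {ℓ : ℕ} → Graph (Fin ℓ) → ℕ
ex m n F =
  maximum (finite⊎ m n) (λ G → bipartite? G ×-dec free? (finite⊎ m n) F G) crossEdges

⌈_/3⌉ : ℕ → ℕ
⌈ n /3⌉ = (n + 2) / 3

------------------------------------------------------------------------
-- t and ex are the maxima they are meant to be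

IsMaximum : {V : Set} → (Graph V → Set) → (Graph V → ℕ) → ℕ → Set₁
IsMaximum P f m = (∃ λ G → P G × f G ≡ m) × (∀ G → P G → f G ≤ m)

_≈_ : {V : Set} → Graph V → Graph V → Set
G ≈ H = (∀ {u v} → Adj G u v → Adj H u v) × (∀ {u v} → Adj H u v → Adj G u v)

filter∈sublists : {A : Set} {P : A → Set} (P? : U.Decidable P) → ∀ xs → filter P? xs ∈ sublists xs
filter∈sublists P? []       = here refl
filter∈sublists P? (x ∷ xs) with does (P? x)
... | true  = ∈-++⁺ˡ (∈-map⁺ (x ∷_) (filter∈sublists P? xs))
... | false = ∈-++⁺ʳ (map (x ∷_) (sublists xs)) (filter∈sublists P? xs)

module _ {V : Set} (fin : Finite V) where
  open Finite fin

  graphs-complete : (G : Graph V) → ∃ λ H → H ∈ graphs fin × G ≈ H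
  graphs-complete G =
    fromPairs fin es , ∈-map⁺ (fromPairs fin) (filter∈sublists P? pairs) ,
    (λ {u} {v} e → (λ u≡v → irrefl G u≡v e) ,
       inj₁ (∈-filter⁺ P? (∈-cartesianProduct⁺ (complete u) (complete v)) e)) ,
    (λ (_ , e) → [ proj₂ ∘ ∈-filter⁻ P? {xs = pairs}
                 , symm G ∘ proj₂ ∘ ∈-filter⁻ P? {xs = pairs} ]′ e)
    where
    pairs = cartesianProduct elements elements
    P? : U.Decidable (λ ((u , v) : V × V) → Adj G u v)
    P? (u , v) = adj? G u v
    es = filter P? pairs

  maximum-isMaximum :
    {P : Graph V → Set} (P? : U.Decidable P) (f : Graph V → ℕ) →
    (∀ {G H} → G ≈ H → P G → P H) → (∀ {G H} → G ≈ H → f G ≡ f H) →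
    ∃ P → IsMaximum P f (maximum fin P? f)
  maximum-isMaximum {P} P? f P-resp f-resp (G₀ , p₀) = attained , upper
    where
    values = map f (filter P? (graphs fin))

    upper : ∀ G → P G → f G ≤ maximum fin P? f
    upper G p with graphs-complete G
    ... | H , H∈ , G≈H = v≤max⁺ 0 values
      (inj₂ (lose (∈-map⁺ f (∈-filter⁺ P? H∈ (P-resp G≈H p))) (ℕ.≤-reflexive (f-resp G≈H))))

    attained : ∃ λ G → P G × f G ≡ maximum fin P? f
    attained with argmax-sel id 0 values
    ... | inj₁ max≡0 = G₀ , p₀ , ℕ.≤-antisym (upper G₀ p₀) (subst (_≤ f G₀) (sym max≡0) z≤n)
    ... | inj₂ max∈ with ∈-map⁻ f max∈
    ...   | G , G∈ , max≡fG = G , proj₂ (∈-filter⁻ P? {xs = graphs fin} G∈) , sym max≡fG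

free-resp : {U V : Set} {F : Graph U} {G H : Graph V} → G ≈ H → F -free G → F -free H
free-resp (_ , H⇒G) free c = free (record
  { embed = embed ; injective = injective ; preserves = H⇒G ∘ preserves })
  where open _⊑_ c

bipartite-resp : ∀ {m n} {G H : Graph (Fin m ⊎ Fin n)} → G ≈ H → Bipartite G → Bipartite H
bipartite-resp (_ , H⇒G) (b₁ , b₂) = (λ i i′ → b₁ i i′ ∘ H⇒G) , (λ j j′ → b₂ j j′ ∘ H⇒G)

triangles-resp : ∀ {n} {G H : Graph (Fin n)} → G ≈ H → triangles G ≡ triangles H
triangles-resp {n} {G} {H} (G⇒H , H⇒G) = cong length (filter-≐ (triangle? G) (triangle? H)
  ( (λ (lt , a , b , c) → lt , G⇒H a , G⇒H b , G⇒H c)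
  , (λ (lt , a , b , c) → lt , H⇒G a , H⇒G b , H⇒G c))
  (cartesianProduct (allFin n) (cartesianProduct (allFin n) (allFin n))))

crossEdges-resp : ∀ {m n} {G H : Graph (Fin m ⊎ Fin n)} → G ≈ H → crossEdges G ≡ crossEdges H
crossEdges-resp {m} {n} {G} {H} (G⇒H , H⇒G) =
  cong length (filter-≐ (cross? G) (cross? H) (G⇒H , H⇒G) (cartesianProduct (allFin m) (allFin n)))

emptyGraph : (V : Set) → Graph V
emptyGraph V = record
  { Adj = λ _ _ → ⊥ ; symm = id ; irrefl = λ _ () ; adj? = λ _ _ → no id }

HasEdge : {V : Set} → Graph V → Set
HasEdge F = ∃ λ i → ∃ λ j → Adj F i j

emptyGraph-free : {U V : Set} {F : Graph U} → HasEdge F → F -free (emptyGraph V)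
emptyGraph-free (_ , _ , e) c = _⊑_.preserves c e

C-hasEdge : ∀ {ℓ} → 3 ≤ ℓ → HasEdge (C ℓ)
C-hasEdge (s≤s (s≤s _)) = zero , suc zero , (λ ()) , inj₁ (inj₁ refl)

t-isMaximum : ∀ {ℓ} → 3 ≤ ℓ → ∀ n → IsMaximum (C ℓ -free_) triangles (t ℓ n)
t-isMaximum {ℓ} 3≤ℓ n =
  maximum-isMaximum (finiteFin n) (free? (finiteFin n) (C ℓ)) triangles free-resp
    (λ {G} {H} → triangles-resp {G = G} {H})
    (emptyGraph (Fin n) , emptyGraph-free (C-hasEdge 3≤ℓ))

ex-isMaximum : ∀ m n {ℓ} {F : Graph (Fin ℓ)} → HasEdge F →
               IsMaximum (λ G → Bipartite G × F -free G) crossEdges (ex m n F)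
ex-isMaximum m n {F = F} e =
  maximum-isMaximum (finite⊎ m n) (λ G → bipartite? G ×-dec free? (finite⊎ m n) F G) crossEdges
    (λ {G} {H} G≈H (b , f) → bipartite-resp {G = G} {H} G≈H b , free-resp G≈H f)
    (λ {G} {H} → crossEdges-resp {G = G} {H})
    (emptyGraph _ , ((λ _ _ ()) , (λ _ _ ())) , emptyGraph-free e)

{-# OPTIONS --safe #-}
module Submission where

-- Among all ways of colouring ⌈n/3⌉ groups of three vertices, each group by a cyclic shift of the
-- colours 0, 1, 2, some colouring makes at least 2/9 of the triangles rainbow: every triple is
-- rainbow for at least 6 of the 27 shifts of the groups of its vertices. The edges of rainbow
-- triangles joining two fixed colours form a bipartite graph on ⌈n/3⌉ + ⌈n/3⌉ vertices which is
-- C_2k-free, for otherwise an apex of the third colour extends the cycle to a C_2k+1. Now delete,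
-- as long as possible, the rainbow triangles through an edge 01 or 02 that lies in at most k - 1
-- of them; this costs k - 1 triangles per edge, hence at most 2(k - 1) ex in total. If a triangle
-- survived, then in the link of its vertex of colour 0 both colour classes would have minimum
-- degree k, and the greedy path on 2k vertices of this bipartite link would give a C_2k+1.

open import Defs
open import Data.Nat.Base using (ℕ; zero; suc; _+_; _*_; _∸_; _^_; _≤_; _<_; z≤n; s≤s⁻¹)
open import Data.Bool.Base using (Bool; true; false; if_then_else_)
import Data.Bool.Properties as Bool
open import Data.Empty using (⊥)
open import Data.Nat.DivMod using (_%_; m≡m%n+[m/n]*n; m%n<n)
open import Data.Nat.Induction using (<-wellFounded)
import Data.Nat.Properties as ℕ
open import Data.List.Extrema.Nat using (argmax; f[xs]≤f[argmax])
open import Data.Nat.Solver using (module +-*-Solver)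
open import Data.Fin.Base as Fin using (Fin; zero; suc; toℕ; fromℕ<; inject≤; combine; remQuot)
open import Data.Fin.Patterns using (0F; 1F; 2F)
import Data.Fin.Properties as Fin
open import Data.List.Base
  using (List; []; _∷_; _++_; map; filter; length; lookup; allFin; cartesianProduct)
open import Data.List.Membership.Propositional using (_∈_; _∉_; find; lose)
open import Data.List.Membership.Propositional.Properties
  using (∈-lookup; ∈-filter⁺; ∈-filter⁻; ∈-map⁺; ∈-++⁺ˡ; ∈-++⁺ʳ; ∈-allFin; ∈-cartesianProduct⁺)
import Data.List.Membership.DecPropositional as DecMembership
open import Data.List.Properties using (filter-notAll; length-map; length-++)
open import Data.List.Relation.Unary.All as All using ([]; _∷_)
open import Data.List.Relation.Unary.All.Properties using (¬Any⇒All¬)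
open import Data.List.Relation.Unary.Any as Any using (here; there; index)
open import Data.List.Relation.Unary.Any.Properties using (lookup-index)
open import Data.List.Relation.Unary.Linked using (Linked; []; [-]; _∷_)
open import Data.List.Relation.Unary.Unique.Propositional using (Unique; []; _∷_)
open import Data.List.Relation.Unary.Unique.Propositional.Properties
  using (filter⁺; allFin⁺; cartesianProduct⁺)
open import Data.Product.Base using (∃; ∃₂; _×_; _,_; proj₁; proj₂)
open import Data.Product.Properties using (≡-dec)
open import Data.Sum.Base using (_⊎_; inj₁; inj₂)
import Data.Sum.Properties as Sum
open import Data.Vec.Base as Vec using (Vec; []; _∷_; updateAt)
open import Data.Vec.Properties using (lookup∘updateAt; lookup∘updateAt′)
open import Function.Base using (_∘_; id)
open import Function.Bundles using (mk⇔)
open import Induction.WellFounded using (Acc; acc)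
open import Relation.Binary.Definitions using (DecidableEquality)
open import Relation.Binary.PropositionalEquality
  using (_≡_; _≢_; refl; sym; trans; cong; cong₂; subst; module ≡-Reasoning)
open import Relation.Nullary using (¬_; Dec; yes; no; does; contradiction)
open import Relation.Nullary.Decidable
  using (¬?; _×-dec_; _→-dec_; dec-true; does-⇔; from-yes; decidable-stable)
open import Relation.Unary using (Decidable)

private variable
  A B : Set

-- Pigeonhole arguments on duplicate-free lists

lookup-injective : {xs : List A} → Unique xs → ∀ {i j} → lookup xs i ≡ lookup xs j → i ≡ j
lookup-injective (_ ∷ _)   {zero}  {zero}  _  = refl
lookup-injective (x∉ ∷ _)  {zero}  {suc j} eq = contradiction eq (All.lookup x∉ (∈-lookup j))
lookup-injective (x∉ ∷ _)  {suc i} {zero}  eq = contradiction (sym eq) (All.lookup x∉ (∈-lookup i))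
lookup-injective (_ ∷ xs!) {suc i} {suc j} eq = cong suc (lookup-injective xs! eq)

lookup-linked : {R : A → A → Set} {xs : List A} → Linked R xs →
                ∀ {i j} → toℕ j ≡ suc (toℕ i) → R (lookup xs i) (lookup xs j)
lookup-linked (r ∷ _)  {zero}  {suc zero} _  = r
lookup-linked (_ ∷ rs) {suc i} {suc j}    eq = lookup-linked rs (ℕ.suc-injective eq)
lookup-linked [-]      {zero}  {zero}     ()

module _ {xs : List A} (xs! : Unique xs) (f : A → B)
         (f-injective : ∀ {x y} → x ∈ xs → y ∈ xs → f x ≡ f y → x ≡ y) where

  injective⇒length≤ : ∀ {ys} → (∀ {x} → x ∈ xs → f x ∈ ys) → length xs ≤ length ys
  injective⇒length≤ {ys} f∈ = Fin.injective⇒≤ {f = λ i → index (f∈ (∈-lookup i))} λ {i} {j} eq →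
    lookup-injective xs! (f-injective (∈-lookup i) (∈-lookup j)
      (trans (lookup-index (f∈ (∈-lookup i)))
        (trans (cong (lookup ys) eq) (sym (lookup-index (f∈ (∈-lookup j)))))))

  injective⇒fresh : DecidableEquality B → ∀ ys → length ys < length xs →
                    ∃ λ x → x ∈ xs × f x ∉ ys
  injective⇒fresh _≟_ ys lt with Any.any? (λ x → ¬? (f x ∈? ys)) xs
    where open DecMembership _≟_ using (_∈?_)
  ... | yes p = find p
  ... | no ¬p = contradiction (ℕ.≤-<-trans (injective⇒length≤ f∈) lt) (ℕ.<-irrefl refl)
    where
    open DecMembership _≟_ using (_∈?_)
    f∈ : ∀ {x} → x ∈ xs → f x ∈ ys
    f∈ {x} x∈ = decidable-stable (f x ∈? ys) (All.lookup (¬Any⇒All¬ xs ¬p) x∈)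

-- Deleting items of low-degree keys

length-filter-∁ : {P : A → Set} (P? : Decidable P) → ∀ xs →
                  length xs ≡ length (filter P? xs) + length (filter (¬? ∘ P?) xs)
length-filter-∁ P? []       = refl
length-filter-∁ P? (x ∷ xs) with does (P? x)
... | true  = cong suc (length-filter-∁ P? xs)
... | false = trans (cong suc (length-filter-∁ P? xs)) (sym (ℕ.+-suc _ _))

module _ {A K : Set} (_≟_ : DecidableEquality K) {_∼_ : K → A → Set}
         (_∼?_ : ∀ q a → Dec (q ∼ a)) where

  degree : K → List A → ℕ
  degree q L = length (filter (q ∼?_) L)

  -- Delete the items of some key of degree at most c for as long as there is one: each key is
  -- used at most once.
  peel : ∀ c Q L → (∀ {a q} → a ∈ L → q ∼ a → q ∈ Q) → Unique L →
         ∃ λ L′ → Unique L′ × (∀ {a} → a ∈ L′ → a ∈ L) ×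
                  (∀ {a q} → a ∈ L′ → q ∼ a → c < degree q L′) ×
                  length L ≤ length L′ + c * length Q
  peel c Q = go Q (<-wellFounded (length Q))
    where
    go : ∀ Q → Acc _<_ (length Q) → ∀ L → (∀ {a q} → a ∈ L → q ∼ a → q ∈ Q) → Unique L →
         ∃ λ L′ → Unique L′ × (∀ {a} → a ∈ L′ → a ∈ L) ×
                  (∀ {a q} → a ∈ L′ → q ∼ a → c < degree q L′) ×
                  length L ≤ length L′ + c * length Q
    go Q (acc rec) L covers L! with Any.any? (λ q → degree q L ℕ.≤? c) Q
    ... | no ¬low = L , L! , id ,
      (λ a∈ q∼a → ℕ.≰⇒> (All.lookup (¬Any⇒All¬ Q ¬low) (covers a∈ q∼a))) , ℕ.m≤m+n _ _
    ... | yes low =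
      let q , q∈Q , deg≤c = find low
          Q₁ = filter (¬? ∘ (q ≟_)) Q
          L₁ = filter (¬? ∘ (q ∼?_)) L
          Q₁<Q : length Q₁ < length Q
          Q₁<Q = filter-notAll (¬? ∘ (q ≟_)) Q (lose q∈Q (λ q≢q → q≢q refl))
          L′ , L′! , L′⊆L₁ , dense , bound = go Q₁ (rec Q₁<Q) L₁
            -- No remaining item has key `q`, so the shorter list `Q₁` still covers everything.
            (λ {a} {q′} a∈ q′∼a →
              let a∈L , q≁a = ∈-filter⁻ (¬? ∘ (q ∼?_)) {xs = L} a∈
              in ∈-filter⁺ (¬? ∘ (q ≟_)) (covers a∈L q′∼a) (λ q≡q′ → q≁a (subst (_∼ a) (sym q≡q′) q′∼a)))
            (filter⁺ (¬? ∘ (q ∼?_)) L!)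
      in L′ , L′! , proj₁ ∘ ∈-filter⁻ (¬? ∘ (q ∼?_)) {xs = L} ∘ L′⊆L₁ , dense , (begin
        length L                                   ≡⟨ length-filter-∁ (q ∼?_) L ⟩
        degree q L + length L₁                     ≤⟨ ℕ.+-mono-≤ deg≤c bound ⟩
        c + (length L′ + c * length Q₁)            ≡⟨ shuffle c (length L′) (length Q₁) ⟩
        -- The at most `c` deleted items are charged to `q`, which occurs in `Q` but not in `Q₁`.
        length L′ + c * suc (length Q₁)            ≤⟨ ℕ.+-monoʳ-≤ (length L′) (ℕ.*-monoʳ-≤ c Q₁<Q) ⟩
        length L′ + c * length Q                   ∎)
      where
      open ℕ.≤-Reasoning
      shuffle : ∀ c l q → c + (l + c * q) ≡ l + c * suc q
      shuffle = solve 3 (λ c l q → c :+ (l :+ c :* q) := l :+ c :* (con 1 :+ q)) refl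
        where open +-*-Solver

-- Greedy paths in a bipartite relation

module _ {V : Set} (E : V → V → Set) where

  -- A path alternating between a left side `xs` and a right side `ys`. It grows at its front by two
  -- vertices at a time, so the front is always on the left. Freshness is recorded within each side
  -- only.
  data Zigzag : List V → List V → Set where
    base   : ∀ {x y} → E x y → Zigzag (x ∷ []) (y ∷ [])
    extend : ∀ {x x′ y xs ys} → E x y → E x′ y → x′ ∉ x ∷ xs → y ∉ ys →
             Zigzag (x ∷ xs) ys → Zigzag (x′ ∷ x ∷ xs) (y ∷ ys)

module _ {V : Set} {E : V → V → Set} where

  vertices : ∀ {xs ys} → Zigzag E xs ys → List V
  vertices (base {x} {y} _)                   = x ∷ y ∷ []
  vertices (extend {x′ = x′} {y = y} _ _ _ _ z) = x′ ∷ y ∷ vertices z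

  zigzag-length : ∀ {xs ys} → Zigzag E xs ys → length ys ≡ length xs
  zigzag-length (base _)           = refl
  zigzag-length (extend _ _ _ _ z) = cong suc (zigzag-length z)

  length-vertices : ∀ {xs ys} (z : Zigzag E xs ys) → length (vertices z) ≡ 2 * length xs
  length-vertices (base _) = refl
  length-vertices (extend {xs = xs} _ _ _ _ z) =
    trans (cong (2 +_) (length-vertices z)) (sym (ℕ.*-suc 2 (suc (length xs))))

  vertices-linked : ∀ {R : V → V → Set} → (∀ {x y} → E x y → R x y) → (∀ {x y} → E x y → R y x) →
                    ∀ {xs ys} (z : Zigzag E xs ys) → Linked R (vertices z)
  vertices-linked f g (base e)                              = f e ∷ [-]
  vertices-linked f g (extend e e′ _ _ z@(base _))           = f e′ ∷ g e ∷ vertices-linked f g z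
  vertices-linked f g (extend e e′ _ _ z@(extend _ _ _ _ _)) = f e′ ∷ g e ∷ vertices-linked f g z

  vertices⊆ : ∀ {xs ys} (z : Zigzag E xs ys) {v} → v ∈ vertices z → v ∈ xs ⊎ v ∈ ys
  vertices⊆ (base _) (here eq)         = inj₁ (here eq)
  vertices⊆ (base _) (there (here eq)) = inj₂ (here eq)
  vertices⊆ (extend _ _ _ _ z) (here eq)         = inj₁ (here eq)
  vertices⊆ (extend _ _ _ _ z) (there (here eq)) = inj₂ (here eq)
  vertices⊆ (extend _ _ _ _ z) (there (there v∈)) with vertices⊆ z v∈
  ... | inj₁ p = inj₁ (there p)
  ... | inj₂ p = inj₂ (there p)

  zigzag-left : ∀ {xs ys} → Zigzag E xs ys → ∀ {v} → v ∈ xs → ∃ (E v)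
  zigzag-left (base e)            (here refl) = _ , e
  zigzag-left (extend _ e _ _ _)  (here refl) = _ , e
  zigzag-left (extend _ _ _ _ z)  (there v∈)  = zigzag-left z v∈

  zigzag-right : ∀ {xs ys} → Zigzag E xs ys → ∀ {v} → v ∈ ys → ∃ λ x → E x v
  zigzag-right (base e)            (here refl) = _ , e
  zigzag-right (extend _ e _ _ _)  (here refl) = _ , e
  zigzag-right (extend _ _ _ _ z)  (there v∈)  = zigzag-right z v∈

  -- No vertex is both a left and a right end of `E`, so freshness within each side excludes all
  -- repetitions.
  vertices-unique : (∀ {v x y} → E v y → ¬ E x v) →
                    ∀ {xs ys} (z : Zigzag E xs ys) → Unique (vertices z)
  vertices-unique disjoint (base e) = ((λ { refl → disjoint e e }) ∷ []) ∷ [] ∷ []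
  vertices-unique disjoint (extend {x′ = x′} {y = y} e e′ x′∉ y∉ z) =
    ((λ { refl → disjoint e′ e′ }) ∷ All.tabulate (λ { v∈ refl → x′∉vs v∈ })) ∷
    All.tabulate (λ { v∈ refl → y∉vs v∈ }) ∷ vertices-unique disjoint z
    where
    x′∉vs : x′ ∉ vertices z
    x′∉vs v∈ with vertices⊆ z v∈
    ... | inj₁ p = x′∉ p
    ... | inj₂ p = disjoint e′ (proj₂ (zigzag-right z p))
    y∉vs : y ∉ vertices z
    y∉vs v∈ with vertices⊆ z v∈
    ... | inj₁ p = disjoint (proj₂ (zigzag-left z p)) e
    ... | inj₂ p = y∉ p

  module _ {c : ℕ}
           (growʳ : ∀ {x y} → E x y → ∀ ys → length ys ≤ c → ∃ λ y′ → y′ ∉ ys × E x y′)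
           (growˡ : ∀ {x y} → E x y → ∀ xs → length xs ≤ c → ∃ λ x′ → x′ ∉ xs × E x′ y) where

    greedy : ∃₂ E → ∀ j → j ≤ c → ∃₂ λ xs ys → Zigzag E xs ys × length xs ≡ suc j
    greedy (x , y , e) zero    _   = _ , _ , base e , refl
    greedy start       (suc j) j<c with greedy start j (ℕ.<⇒≤ j<c)
    ... | (x ∷ xs) , ys , z , refl =
      -- Any edge at the front `x` will do here: it only certifies that `growʳ` applies to `x`.
      let e₀ = proj₂ (zigzag-left z (here refl))
          y , y∉ , e = growʳ e₀ ys (subst (_≤ c) (sym (zigzag-length z)) j<c)
          x′ , x′∉ , e′ = growˡ e (x ∷ xs) j<c
      in _ , _ , extend e e′ x′∉ y∉ z , refl

-- Building cycles

closePath : {V : Set} (G : Graph V) {ℓ : ℕ} (p : Fin ℓ → V) (w : V) →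
            (∀ {i j} → p i ≡ p j → i ≡ j) → (∀ {i} → w ≢ p i) →
            (∀ {i j} → toℕ j ≡ suc (toℕ i) → Adj G (p i) (p j)) →
            (∀ {i} → toℕ i ≡ 0 → Adj G w (p i)) →
            (∀ {i} → suc (toℕ i) ≡ ℓ → Adj G w (p i)) →
            C (suc ℓ) ⊑ G
closePath {V} G {ℓ} p w p-injective w∉p steps first last = record
  { embed = q ; injective = q-injective ; preserves = preserves }
  where
  -- With `w` at place 0 and the path at places 1 to `ℓ`, the wrap-around of `Next` is the edge from
  -- the end of the path to `w`.
  q : Fin (suc ℓ) → V
  q zero    = w
  q (suc i) = p i

  q-injective : ∀ {i j} → q i ≡ q j → i ≡ j
  q-injective {zero}  {zero}  _  = refl
  q-injective {zero}  {suc j} eq = contradiction eq w∉p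
  q-injective {suc i} {zero}  eq = contradiction (sym eq) w∉p
  q-injective {suc i} {suc j} eq = cong suc (p-injective eq)

  next : ∀ {i j} → i ≢ j → Next i j → Adj G (q i) (q j)
  next {zero}  {zero}  i≢j _               = contradiction refl i≢j
  next {zero}  {suc j} _   (inj₁ eq)       = first (ℕ.suc-injective eq)
  next {suc i} {zero}  _   (inj₂ (eq , _)) = symm G (last (ℕ.suc-injective eq))
  next {suc i} {suc j} _   (inj₁ eq)       = steps (ℕ.suc-injective eq)

  preserves : ∀ {i j} → Adj (C (suc ℓ)) i j → Adj G (q i) (q j)
  preserves (i≢j , inj₁ e) = next i≢j e
  preserves (i≢j , inj₂ e) = symm G (next (i≢j ∘ sym) e)

C-consecutive : ∀ {ℓ} {i j : Fin ℓ} → toℕ j ≡ suc (toℕ i) → Adj (C ℓ) i j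
C-consecutive eq = (λ { refl → ℕ.1+n≢n (sym eq) }) , inj₁ (inj₁ eq)

C-closing : ∀ {ℓ} {i j : Fin ℓ} → 2 ≤ ℓ → suc (toℕ i) ≡ ℓ → toℕ j ≡ 0 → Adj (C ℓ) i j
C-closing {i = i} 2≤ℓ i-last j≡0 =
  (λ { refl → ℕ.<-irrefl (trans (cong suc (sym j≡0)) i-last) 2≤ℓ }) , inj₁ (inj₂ (i-last , j≡0))

-- Lifting a cycle out of the projection works edge by edge, so each of its vertices needs some edge
-- to be lifted along.
C-neighbour : ∀ {ℓ} → 2 ≤ ℓ → ∀ i → ∃ (Adj (C ℓ) i)
C-neighbour {suc ℓ} 2≤ℓ i with suc (toℕ i) ℕ.≟ suc ℓ
... | yes i-last = zero , C-closing 2≤ℓ i-last refl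
... | no ¬last   = fromℕ< i+1<ℓ , C-consecutive (Fin.toℕ-fromℕ< i+1<ℓ)
  where
  i+1<ℓ : suc (toℕ i) < suc ℓ
  i+1<ℓ = ℕ.≤∧≢⇒< (Fin.toℕ<n i) ¬last

-- Edges of rainbow triangles, projected to pairs of groups

module Shadow {n m : ℕ} (G : Graph (Fin n)) (colour : Fin n → Fin 3) (group : Fin n → Fin m)
              (colour-group-injective : ∀ {u v} → colour u ≡ colour v → group u ≡ group v → u ≡ v)
              where

  IsShadow : (a b c : Fin 3) → Fin n × Fin n → Set
  IsShadow a b c (u , v) =
    colour u ≡ a × colour v ≡ b × Adj G u v × ∃ λ w → colour w ≡ c × Adj G w u × Adj G w v

  isShadow? : ∀ a b c → Decidable (IsShadow a b c)
  isShadow? a b c (u , v) =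
    (colour u Fin.≟ a) ×-dec (colour v Fin.≟ b) ×-dec adj? G u v ×-dec
    Fin.any? (λ w → (colour w Fin.≟ c) ×-dec adj? G w u ×-dec adj? G w v)

  shadow : (a b c : Fin 3) → List (Fin n × Fin n)
  shadow a b c = filter (isShadow? a b c) (cartesianProduct (allFin n) (allFin n))

  ∈-shadow : ∀ {a b c u v} → IsShadow a b c (u , v) → (u , v) ∈ shadow a b c
  ∈-shadow {a} {b} {c} {u} {v} =
    ∈-filter⁺ (isShadow? a b c) (∈-cartesianProduct⁺ (∈-allFin u) (∈-allFin v))

  module _ {a b c : Fin 3} (a≢b : a ≢ b) (a≢c : a ≢ c) (b≢c : b ≢ c) where

    -- A group has at most one vertex of each colour, so once the colours `a` and `b` are fixed,
    -- replacing endpoints by their groups loses nothing.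
    Projected : Fin m → Fin m → Set
    Projected i j = ∃ λ u → ∃ λ v → IsShadow a b c (u , v) × group u ≡ i × group v ≡ j

    projected? : ∀ i j → Dec (Projected i j)
    projected? i j = Fin.any? λ u → Fin.any? λ v →
      isShadow? a b c (u , v) ×-dec (group u Fin.≟ i) ×-dec (group v Fin.≟ j)

    ProjectedAdj : Fin m ⊎ Fin m → Fin m ⊎ Fin m → Set
    ProjectedAdj (inj₁ i) (inj₂ j) = Projected i j
    ProjectedAdj (inj₂ j) (inj₁ i) = Projected i j
    ProjectedAdj (inj₁ _) (inj₁ _) = ⊥
    ProjectedAdj (inj₂ _) (inj₂ _) = ⊥

    projection : Graph (Fin m ⊎ Fin m)
    projection = record
      { Adj = ProjectedAdj ; symm = λ {p} {q} → sym′ {p} {q} ; irrefl = irrefl′ ; adj? = dec }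
      where
      sym′ : ∀ {p q} → ProjectedAdj p q → ProjectedAdj q p
      sym′ {inj₁ _} {inj₂ _} e = e
      sym′ {inj₂ _} {inj₁ _} e = e
      irrefl′ : ∀ {p q} → p ≡ q → ¬ ProjectedAdj p q
      irrefl′ {inj₁ _} refl ()
      irrefl′ {inj₂ _} refl ()
      dec : ∀ p q → Dec (ProjectedAdj p q)
      dec (inj₁ i) (inj₂ j) = projected? i j
      dec (inj₂ j) (inj₁ i) = projected? i j
      dec (inj₁ _) (inj₁ _) = no λ ()
      dec (inj₂ _) (inj₂ _) = no λ ()

    -- A relation and not a function, since a group may lack a vertex of the given colour.
    Over : Fin m ⊎ Fin m → Fin n → Set
    Over (inj₁ i) u = colour u ≡ a × group u ≡ i
    Over (inj₂ j) u = colour u ≡ b × group u ≡ j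

    over-unique : ∀ {p u v} → Over p u → Over p v → u ≡ v
    over-unique {inj₁ _} (cu , gu) (cv , gv) =
      colour-group-injective (trans cu (sym cv)) (trans gu (sym gv))
    over-unique {inj₂ _} (cu , gu) (cv , gv) =
      colour-group-injective (trans cu (sym cv)) (trans gu (sym gv))

    over-injective : ∀ {p q u} → Over p u → Over q u → p ≡ q
    over-injective {inj₁ _} {inj₁ _} (_ , refl) (_ , refl) = refl
    over-injective {inj₁ _} {inj₂ _} (refl , _) (eq , _)   = contradiction eq a≢b
    over-injective {inj₂ _} {inj₁ _} (refl , _) (eq , _)   = contradiction (sym eq) a≢b
    over-injective {inj₂ _} {inj₂ _} (_ , refl) (_ , refl) = refl

    -- This keeps an apex, which has colour `c`, off the lifted cycle.
    over-colour : ∀ {p u} → Over p u → colour u ≢ c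
    over-colour {inj₁ _} (refl , _) = a≢c
    over-colour {inj₂ _} (refl , _) = b≢c

    -- `IsShadow` without the colours of the endpoints, so that a cycle may run through its edges in
    -- both directions.
    Lifted : Fin n → Fin n → Set
    Lifted u v = Adj G u v × ∃ λ w → colour w ≡ c × Adj G w u × Adj G w v

    lift : ∀ {p q} → ProjectedAdj p q → ∃₂ λ u v → Over p u × Over q v × Lifted u v
    lift {inj₁ _} {inj₂ _} (u , v , (cu , cv , e) , gu , gv) = u , v , (cu , gu) , (cv , gv) , e
    lift {inj₂ _} {inj₁ _} (u , v , (cu , cv , e , w , cw , eu , ev) , gu , gv) =
      v , u , (cv , gv) , (cu , gu) , symm G e , w , cw , ev , eu

    -- The apex of one edge of an ℓ-cycle has the third colour, so rerouting the edge through it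
    -- gives an (ℓ+1)-cycle.
    projection-free : ∀ {ℓ} → 2 ≤ ℓ → C (suc ℓ) -free G → C ℓ -free projection
    projection-free {suc ℓ} 2≤ℓ free copy = free (closePath G g apex
        g-injective
        (λ {i} eq → over-colour (g-over i) (trans (cong colour (sym eq)) apex-colour))
        (λ eq → proj₁ (g-lifted (C-consecutive eq)))
        (λ eq → subst (Adj G apex ∘ g) (sym (Fin.toℕ-injective eq)) apex-first)
        (λ eq → subst (Adj G apex ∘ g)
          (Fin.toℕ-injective (trans (Fin.toℕ-fromℕ ℓ) (sym (ℕ.suc-injective eq)))) apex-last))
      where
      open _⊑_ copy

      lifted : ∀ i → ∃ λ u → Over (embed i) u
      lifted i = let u , _ , over , _ = lift {embed i} (preserves (proj₂ (C-neighbour 2≤ℓ i))) in u , over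

      g : Fin (suc ℓ) → Fin n
      g = proj₁ ∘ lifted

      g-over : ∀ i → Over (embed i) (g i)
      g-over = proj₂ ∘ lifted

      g-injective : ∀ {i j} → g i ≡ g j → i ≡ j
      g-injective {i} {j} eq =
        injective (over-injective (g-over i) (subst (Over (embed j)) (sym eq) (g-over j)))

      g-lifted : ∀ {i j} → Adj (C (suc ℓ)) i j → Lifted (g i) (g j)
      g-lifted {i} {j} e with lift {embed i} {embed j} (preserves e)
      ... | u , v , ou , ov , l
        -- Each vertex was lifted along one chosen edge; uniqueness over a projected vertex
        -- identifies that lift with the endpoint found along any other edge.
        with refl ← over-unique {embed i} (g-over i) ou
           | refl ← over-unique {embed j} (g-over j) ov = l

      -- The edge from the last vertex back to vertex 0 is the one rerouted through its apex.
      closing : Lifted (g (Fin.fromℕ ℓ)) (g zero)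
      closing = g-lifted (C-closing 2≤ℓ (cong suc (Fin.toℕ-fromℕ ℓ)) refl)

      apex = proj₁ (proj₂ closing)
      apex-colour = proj₁ (proj₂ (proj₂ closing))
      apex-last = proj₁ (proj₂ (proj₂ (proj₂ closing)))
      apex-first = proj₂ (proj₂ (proj₂ (proj₂ closing)))

    -- Shadow edges inject into the edges of `projection`, which competes in the maximum defining
    -- `ex`.
    length-shadow≤ex : ∀ {ℓ} → 3 ≤ ℓ → C (suc ℓ) -free G → length (shadow a b c) ≤ ex m m (C ℓ)
    length-shadow≤ex {ℓ} 3≤ℓ free = ℕ.≤-trans
      (injective⇒length≤ (filter⁺ (isShadow? a b c) (cartesianProduct⁺ (allFin⁺ n) (allFin⁺ n)))
        (λ (u , v) → group u , group v)
        (λ {(u , v)} {(u′ , v′)} p∈ q∈ eq →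
          let cu , cv , _ = isShadow p∈
              cu′ , cv′ , _ = isShadow q∈
          in cong₂ _,_
            (colour-group-injective (trans cu (sym cu′)) (cong proj₁ eq))
            (colour-group-injective (trans cv (sym cv′)) (cong proj₂ eq)))
        (λ {(u , v)} p∈ → ∈-filter⁺ (cross? projection)
          (∈-cartesianProduct⁺ (∈-allFin (group u)) (∈-allFin (group v)))
          (u , v , isShadow p∈ , refl , refl)))
      (proj₂ (ex-isMaximum m m (C-hasEdge 3≤ℓ)) projection
        (((λ _ _ ()) , (λ _ _ ())) , projection-free (ℕ.<⇒≤ 3≤ℓ) free))
      where
      isShadow : ∀ {p} → p ∈ shadow a b c → IsShadow a b c p
      isShadow = proj₂ ∘ ∈-filter⁻ (isShadow? a b c) {xs = cartesianProduct (allFin n) (allFin n)}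

-- Triples of colours

Distinct : Fin 3 → Fin 3 → Fin 3 → Set
Distinct p q r = p ≢ q × q ≢ r × p ≢ r

distinct? : ∀ p q r → Dec (Distinct p q r)
distinct? p q r = ¬? (p Fin.≟ q) ×-dec ¬? (q Fin.≟ r) ×-dec ¬? (p Fin.≟ r)

distinct-exhaust : ∀ {p q r} → Distinct p q r → ∀ a → p ≢ a → q ≢ a → r ≡ a
distinct-exhaust {p} {q} {r} = from-yes (Fin.all? λ p → Fin.all? λ q → Fin.all? λ r →
  distinct? p q r →-dec Fin.all? λ a → ¬? (p Fin.≟ a) →-dec ¬? (q Fin.≟ a) →-dec (r Fin.≟ a)) p q r

-- Averaging over cyclic shifts

infixr 6 _⊕_
-- Addition modulo 3.
_⊕_ : Fin 3 → Fin 3 → Fin 3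
zero         ⊕ y = y
suc zero     ⊕ zero         = suc zero
suc zero     ⊕ suc zero     = suc (suc zero)
suc zero     ⊕ suc (suc _)  = zero
suc (suc _)  ⊕ zero         = suc (suc zero)
suc (suc _)  ⊕ suc zero     = zero
suc (suc _)  ⊕ suc (suc _)  = suc zero

⊕-assoc : ∀ x y z → (x ⊕ y) ⊕ z ≡ x ⊕ (y ⊕ z)
⊕-assoc = from-yes (Fin.all? λ x → Fin.all? λ y → Fin.all? λ z →
  ((x ⊕ y) ⊕ z) Fin.≟ (x ⊕ (y ⊕ z)))

⊕-cancelˡ : ∀ x y z → x ⊕ y ≡ x ⊕ z → y ≡ z
⊕-cancelˡ = from-yes (Fin.all? λ x → Fin.all? λ y → Fin.all? λ z →
  ((x ⊕ y) Fin.≟ (x ⊕ z)) →-dec (y Fin.≟ z))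

Σ₃ : (Fin 3 → ℕ) → ℕ
Σ₃ h = h zero + (h (suc zero) + h (suc (suc zero)))

Σ₃-cong : ∀ {g h} → (∀ x → g x ≡ h x) → Σ₃ g ≡ Σ₃ h
Σ₃-cong eq = cong₂ _+_ (eq _) (cong₂ _+_ (eq _) (eq _))

Σ₃-⊕ : ∀ x h → Σ₃ (λ y → h (x ⊕ y)) ≡ Σ₃ h
Σ₃-⊕ zero          h = refl
Σ₃-⊕ (suc zero)    h = solve 3 (λ a b c → b :+ (c :+ a) := a :+ (b :+ c)) refl (h _) (h _) (h _)
  where open +-*-Solver
Σ₃-⊕ (suc (suc _)) h = solve 3 (λ a b c → c :+ (a :+ b) := a :+ (b :+ c)) refl (h _) (h _) (h _)
  where open +-*-Solver

total : ∀ m → (Vec (Fin 3) m → ℕ) → ℕ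
total zero    f = f []
total (suc m) f = Σ₃ λ x → total m λ s → f (x ∷ s)

total-mono : ∀ m {f g} → (∀ s → f s ≤ g s) → total m f ≤ total m g
total-mono zero    f≤g = f≤g []
total-mono (suc m) f≤g = ℕ.+-mono-≤ (each _) (ℕ.+-mono-≤ (each _) (each _))
  where each = λ x → total-mono m (λ s → f≤g (x ∷ s))

total-cong : ∀ m {f g} → (∀ s → f s ≡ g s) → total m f ≡ total m g
total-cong m eq = ℕ.≤-antisym (total-mono m (ℕ.≤-reflexive ∘ eq)) (total-mono m (ℕ.≤-reflexive ∘ sym ∘ eq))

total-const : ∀ m c → total m (λ _ → c) ≡ c * 3 ^ m
total-const zero    c = sym (ℕ.*-identityʳ c)
total-const (suc m) c rewrite total-const m c =
  solve 2 (λ c t → c :* t :+ (c :* t :+ c :* t) := c :* (con 3 :* t)) refl c (3 ^ m)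
  where open +-*-Solver

total-+ : ∀ m f g → total m (λ s → f s + g s) ≡ total m f + total m g
total-+ zero    f g = refl
total-+ (suc m) f g = trans
  (Σ₃-cong λ x → total-+ m (λ s → f (x ∷ s)) (λ s → g (x ∷ s)))
  (solve 6 (λ a b c a′ b′ c′ → (a :+ a′) :+ ((b :+ b′) :+ (c :+ c′)) := (a :+ (b :+ c)) :+ (a′ :+ (b′ :+ c′)))
    refl (F _) (F _) (F _) (F′ _) (F′ _) (F′ _))
  where
  open +-*-Solver
  F = λ x → total m (λ s → f (x ∷ s))
  F′ = λ x → total m (λ s → g (x ∷ s))

shift : ∀ {m} → Fin m → Fin 3 → Vec (Fin 3) m → Vec (Fin 3) m
shift i x s = updateAt s i (x ⊕_)

-- Shifting one coordinate permutes the vectors, so the sum is only reordered.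
total-shift : ∀ {m} i x (f : Vec (Fin 3) m → ℕ) → total m (f ∘ shift i x) ≡ total m f
total-shift {suc m} zero    x f = Σ₃-⊕ x (λ y → total m λ s → f (y ∷ s))
total-shift {suc m} (suc i) x f = Σ₃-cong λ y → total-shift i x (λ s → f (y ∷ s))

-- The sum over the orbit of `s` under shifts of one group. Smearing multiplies the total by 3, so a
-- total can be bounded from below by a pointwise bound on orbits.
smear : ∀ {m} → Fin m → (Vec (Fin 3) m → ℕ) → Vec (Fin 3) m → ℕ
smear i f s = Σ₃ λ x → f (shift i x s)

total-smear : ∀ {m} i (f : Vec (Fin 3) m → ℕ) → total m (smear i f) ≡ 3 * total m f
total-smear {m} i f = begin
  total m (smear i f)
    ≡⟨ total-+ m _ _ ⟩
  total m (f ∘ shift i _) + total m (λ s → f (shift i _ s) + f (shift i _ s))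
    ≡⟨ cong₂ _+_ (total-shift i _ f) (trans (total-+ m _ _) (cong₂ _+_ (total-shift i _ f) (total-shift i _ f))) ⟩
  total m f + (total m f + total m f)
    ≡⟨ cong (λ t → total m f + (total m f + t)) (sym (ℕ.+-identityʳ _)) ⟩
  3 * total m f ∎
  where open ≡-Reasoning

-- The maximiser is found one coordinate at a time, always fixing the value with the largest
-- remaining total.
average≤max : ∀ m f → ∃ λ s → total m f ≤ 3 ^ m * f s
average≤max zero    f = [] , ℕ.≤-reflexive (sym (ℕ.+-identityʳ _))
average≤max (suc m) f = x* ∷ proj₁ (average≤max m (λ s → f (x* ∷ s))) , (begin
    Σ₃ F                ≤⟨ ℕ.+-mono-≤ (F≤ _) (ℕ.+-mono-≤ (F≤ _) (F≤ _)) ⟩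
    F x* + (F x* + F x*) ≡⟨ cong (λ t → F x* + (F x* + t)) (sym (ℕ.+-identityʳ _)) ⟩
    3 * F x*            ≤⟨ ℕ.*-monoʳ-≤ 3 (proj₂ (average≤max m (λ s → f (x* ∷ s)))) ⟩
    3 * (3 ^ m * _)     ≡⟨ sym (ℕ.*-assoc 3 (3 ^ m) _) ⟩
    3 ^ suc m * _       ∎)
  where
  open ℕ.≤-Reasoning
  F : Fin 3 → ℕ
  F x = total m (λ s → f (x ∷ s))
  largest : ∃ λ x → ∀ y → F y ≤ F x
  largest = argmax F Fin.zero (allFin 3) , λ y → All.lookup (f[xs]≤f[argmax] {f = F} Fin.zero (allFin 3)) (∈-allFin y)
  x* = proj₁ largest
  F≤ = proj₂ largest

indicator : {P : Set} → Dec P → ℕ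
indicator d = if does d then 1 else 0

-- Double counting of pairs of a vector and an item. The proportion is kept as the two factors `b`
-- and `d` to avoid division.
total-filter : ∀ {m b d} {R : Vec (Fin 3) m → A → Set} (R? : ∀ s a → Dec (R s a)) → ∀ L →
               (∀ {a} → a ∈ L → b ≤ d * total m (λ s → indicator (R? s a))) →
               b * length L ≤ d * total m (λ s → length (filter (R? s) L))
total-filter {b = b} R? [] each = ℕ.≤-trans (ℕ.≤-reflexive (ℕ.*-zeroʳ b)) z≤n
total-filter {m = m} {b} {d} R? (a ∷ L) each = begin
  b * suc (length L)
    ≡⟨ ℕ.*-suc b (length L) ⟩
  b + b * length L
    ≤⟨ ℕ.+-mono-≤ (each (here refl)) (total-filter {d = d} R? L (each ∘ there)) ⟩
  d * total m (λ s → indicator (R? s a)) + d * total m (λ s → length (filter (R? s) L))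
    ≡⟨ sym (ℕ.*-distribˡ-+ d _ _) ⟩
  d * (total m (λ s → indicator (R? s a)) + total m (λ s → length (filter (R? s) L)))
    ≡⟨ cong (d *_) (sym (total-+ m _ _)) ⟩
  d * total m (λ s → indicator (R? s a) + length (filter (R? s) L))
    ≡⟨ cong (d *_) (total-cong m split) ⟩
  d * total m (λ s → length (filter (R? s) (a ∷ L))) ∎
  where
  open ℕ.≤-Reasoning
  split : ∀ s → indicator (R? s a) + length (filter (R? s) L) ≡ length (filter (R? s) (a ∷ L))
  split s with does (R? s a)
  ... | true  = refl
  ... | false = refl

-- Rainbow triples under shifts of groups

mask : Bool → Fin 3 → Fin 3
mask b x = if b then x else zero

-- α, β, γ say whether the first and second, second and third, first and third of three vertices of
-- colours p, q, r lie in the same group; the shifts of these groups by x, y, z are then composed.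
module _ (α β γ : Bool) (p q r : Fin 3) where

  distinctShifts : ℕ
  distinctShifts = Σ₃ λ x → Σ₃ λ y → Σ₃ λ z → indicator (distinct?
    (mask γ z ⊕ mask α y ⊕ x ⊕ p)
    (mask β z ⊕ y ⊕ mask α x ⊕ q)
    (z ⊕ mask β y ⊕ mask γ x ⊕ r))

  -- Vertices sharing a group have different colours. The worst case is three different groups, with
  -- 6 good shifts out of 27; two vertices in one group and the third elsewhere give 9, a single
  -- group gives 27.
  Enough : Set
  Enough = (α ≡ true → p ≢ q) → (β ≡ true → q ≢ r) → (γ ≡ true → p ≢ r) → 6 ≤ distinctShifts

  enough? : Dec Enough
  enough? = ((α Bool.≟ true) →-dec ¬? (p Fin.≟ q)) →-dec ((β Bool.≟ true) →-dec ¬? (q Fin.≟ r)) →-dec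
    ((γ Bool.≟ true) →-dec ¬? (p Fin.≟ r)) →-dec (6 ℕ.≤? distinctShifts)

-- A finite check over all colours. It includes the patterns of `α`, `β`, `γ` that no partition into
-- groups produces.
enough : ∀ α β γ p q r → Enough α β γ p q r
enough false false false = from-yes (Fin.all? λ p → Fin.all? λ q → Fin.all? λ r → enough? false false false p q r)
enough false false true  = from-yes (Fin.all? λ p → Fin.all? λ q → Fin.all? λ r → enough? false false true p q r)
enough false true  false = from-yes (Fin.all? λ p → Fin.all? λ q → Fin.all? λ r → enough? false true false p q r)
enough false true  true  = from-yes (Fin.all? λ p → Fin.all? λ q → Fin.all? λ r → enough? false true true p q r)
enough true  false false = from-yes (Fin.all? λ p → Fin.all? λ q → Fin.all? λ r → enough? true false false p q r)
enough true  false true  = from-yes (Fin.all? λ p → Fin.all? λ q → Fin.all? λ r → enough? true false true p q r)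
enough true  true  false = from-yes (Fin.all? λ p → Fin.all? λ q → Fin.all? λ r → enough? true true false p q r)
enough true  true  true  = from-yes (Fin.all? λ p → Fin.all? λ q → Fin.all? λ r → enough? true true true p q r)

indicator-cong : ∀ {p p′ q q′ r r′} → p ≡ p′ → q ≡ q′ → r ≡ r′ →
                 indicator (distinct? p q r) ≡ indicator (distinct? p′ q′ r′)
indicator-cong refl refl refl = refl

≟-refl : ∀ {m} (i : Fin m) → does (i Fin.≟ i) ≡ true
≟-refl i = dec-true (i Fin.≟ i) refl

≟-sym : ∀ {m} (i j : Fin m) → does (i Fin.≟ j) ≡ does (j Fin.≟ i)
≟-sym i j = does-⇔ (mk⇔ sym sym) (i Fin.≟ j) (j Fin.≟ i)

module Colouring {V : Set} {m : ℕ} (group : V → Fin m) (label : V → Fin 3)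
                 (group-label-injective : ∀ {u v} → group u ≡ group v → label u ≡ label v → u ≡ v)
                 where

  colour : Vec (Fin 3) m → V → Fin 3
  colour s v = Vec.lookup s (group v) ⊕ label v

  colour-group-injective : ∀ s {u v} → colour s u ≡ colour s v → group u ≡ group v → u ≡ v
  colour-group-injective s {u} {v} c g = group-label-injective g
    (⊕-cancelˡ (Vec.lookup s (group u)) (label u) (label v)
      (trans c (cong (λ i → Vec.lookup s i ⊕ label v) (sym g))))

  colour-shift : ∀ s i x v → colour (shift i x s) v ≡ mask (does (group v Fin.≟ i)) x ⊕ colour s v
  colour-shift s i x v with group v Fin.≟ i
  ... | yes refl = trans (cong (_⊕ label v) (lookup∘updateAt (group v) s)) (⊕-assoc x _ _)
  ... | no  v∉i  = cong (_⊕ label v) (lookup∘updateAt′ (group v) i v∉i s)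

  Rainbow : Vec (Fin 3) m → V × V × V → Set
  Rainbow s (u , v , w) = Distinct (colour s u) (colour s v) (colour s w)

  rainbow? : ∀ s t → Dec (Rainbow s t)
  rainbow? s (u , v , w) = distinct? (colour s u) (colour s v) (colour s w)

  -- Shifting only the groups of u, v and w already makes the triple rainbow for 6 of the 27 shifts.
  rainbow-average : ∀ {u v w} → u ≢ v → v ≢ w → u ≢ w →
                    6 * 3 ^ m ≤ 27 * total m (λ s → indicator (rainbow? s (u , v , w)))
  rainbow-average {u} {v} {w} u≢v v≢w u≢w = begin
    6 * 3 ^ m                               ≡⟨ sym (total-const m 6) ⟩
    total m (λ _ → 6)                       ≤⟨ total-mono m pointwise ⟩
    total m (smear k (smear j (smear i f))) ≡⟨ total-smear k _ ⟩
    3 * total m (smear j (smear i f))       ≡⟨ cong (3 *_) (total-smear j _) ⟩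
    3 * (3 * total m (smear i f))           ≡⟨ cong (λ t → 3 * (3 * t)) (total-smear i f) ⟩
    3 * (3 * (3 * total m f))               ≡⟨ solve 1 (λ t → con 3 :* (con 3 :* (con 3 :* t)) := con 27 :* t) refl (total m f) ⟩
    27 * total m f                          ∎
    where
    open ℕ.≤-Reasoning
    open +-*-Solver
    i = group w
    j = group v
    k = group u
    f = λ s → indicator (rainbow? s (u , v , w))
    pointwise : ∀ s → 6 ≤ smear k (smear j (smear i f)) s
    -- Each comparison of groups becomes `true` or one of the three Booleans, which turns the
    -- smeared indicator into `distinctShifts`.
    pointwise s = subst (6 ≤_)
      (Σ₃-cong λ x → Σ₃-cong λ y → Σ₃-cong λ z → indicator-cong
        (recolour x y z u refl refl (≟-refl k))
        (recolour x y z v refl (≟-refl j) (≟-sym j k))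
        (recolour x y z w (≟-refl i) (≟-sym i j) (≟-sym i k)))
      (enough (does (k Fin.≟ j)) (does (j Fin.≟ i)) (does (k Fin.≟ i)) _ _ _
        (separate u≢v) (separate v≢w) (separate u≢w))
      where
      recolour : ∀ x y z t {α β γ} → does (group t Fin.≟ i) ≡ α → does (group t Fin.≟ j) ≡ β →
        does (group t Fin.≟ k) ≡ γ →
        mask α z ⊕ mask β y ⊕ mask γ x ⊕ colour s t ≡ colour (shift i z (shift j y (shift k x s))) t
      recolour x y z t {α} {β} refl refl refl = sym (trans
        (colour-shift (shift j y (shift k x s)) i z t)
        (cong (mask α z ⊕_) (trans
          (colour-shift (shift k x s) j y t)
          (cong (mask β y ⊕_) (colour-shift s k x t)))))

      separate : ∀ {u v} → u ≢ v → does (group u Fin.≟ group v) ≡ true → colour s u ≢ colour s v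
      separate {u} {v} u≢v _ eq with group u Fin.≟ group v
      ... | yes same = u≢v (colour-group-injective s eq same)

-- Triangles as increasing triples

corners : ∀ {n} → Fin n × Fin n × Fin n → List (Fin n)
corners (u , v , w) = u ∷ v ∷ w ∷ []

Increasing : ∀ {n} → Fin n × Fin n × Fin n → Set
Increasing (u , v , w) = u Fin.< v × v Fin.< w

-- Equal sets of corners have the same least and the same greatest element, and the middle corner is
-- neither of them.
increasing-antisym : ∀ {n} {t t′ : Fin n × Fin n × Fin n} → Increasing t → Increasing t′ →
  (∀ {x} → x ∈ corners t → x ∈ corners t′) → (∀ {x} → x ∈ corners t′ → x ∈ corners t) → t ≡ t′
increasing-antisym {t = u , v , w} {u′ , v′ , w′} i i′ t⊆t′ t′⊆t =
  cong₂ _,_ u≡u′ (cong₂ _,_ v≡v′ w≡w′)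
  where
  lowest : ∀ {u v w x} → Increasing (u , v , w) → x ∈ corners (u , v , w) → u Fin.≤ x
  lowest _           (here refl)                 = Fin.≤-refl
  lowest (u<v , _)   (there (here refl))         = ℕ.<⇒≤ u<v
  lowest (u<v , v<w) (there (there (here refl))) = ℕ.<⇒≤ (ℕ.<-trans u<v v<w)

  highest : ∀ {u v w x} → Increasing (u , v , w) → x ∈ corners (u , v , w) → x Fin.≤ w
  highest (u<v , v<w) (here refl)                 = ℕ.<⇒≤ (ℕ.<-trans u<v v<w)
  highest (_ , v<w)   (there (here refl))         = ℕ.<⇒≤ v<w
  highest _           (there (there (here refl))) = Fin.≤-refl

  u≡u′ : u ≡ u′
  u≡u′ = Fin.≤-antisym (lowest i (t′⊆t (here refl))) (lowest i′ (t⊆t′ (here refl)))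

  w≡w′ : w ≡ w′
  w≡w′ = Fin.≤-antisym (highest i′ (t⊆t′ (there (there (here refl)))))
                       (highest i (t′⊆t (there (there (here refl)))))

  v≡v′ : v ≡ v′
  v≡v′ with t⊆t′ (there (here refl))
  ... | here v≡u′                 = contradiction (trans u≡u′ (sym v≡u′)) (Fin.<⇒≢ (proj₁ i))
  ... | there (here eq)           = eq
  ... | there (there (here v≡w′)) = contradiction (trans v≡w′ (sym w≡w′)) (Fin.<⇒≢ (proj₂ i))

corners-adjacent : ∀ {n} (G : Graph (Fin n)) {t} → Triangle G t →
                   ∀ {x y} → x ∈ corners t → y ∈ corners t → x ≢ y → Adj G x y
corners-adjacent G (_ , uv , vw , uw) = λ where
  (here refl)                 (here refl)                 x≢y → contradiction refl x≢y
  (here refl)                 (there (here refl))         _   → uv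
  (here refl)                 (there (there (here refl))) _   → uw
  (there (here refl))         (here refl)                 _   → symm G uv
  (there (here refl))         (there (here refl))         x≢y → contradiction refl x≢y
  (there (here refl))         (there (there (here refl))) _   → vw
  (there (there (here refl))) (here refl)                 _   → symm G uw
  (there (there (here refl))) (there (here refl))         _   → symm G vw
  (there (there (here refl))) (there (there (here refl))) x≢y → contradiction refl x≢y

-- Rainbow triangles and their links

module Rainbows {n m : ℕ} (G : Graph (Fin n)) (colour : Fin n → Fin 3) (group : Fin n → Fin m)
                (colour-group-injective : ∀ {u v} → colour u ≡ colour v → group u ≡ group v → u ≡ v)
                where

  open Shadow G colour group colour-group-injective

  Triple = Fin n × Fin n × Fin n

  Rainbow : Triple → Set
  Rainbow (u , v , w) = Distinct (colour u) (colour v) (colour w)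

  -- The corner of colour `a` of a rainbow triple. The default `w` is then correct, because three
  -- distinct colours exhaust `Fin 3`.
  pick : Fin 3 → Triple → Fin n
  pick a (u , v , w) =
    if does (colour u Fin.≟ a) then u else if does (colour v Fin.≟ a) then v else w

  pick∈corners : ∀ a t → pick a t ∈ corners t
  pick∈corners a (u , v , w) with does (colour u Fin.≟ a) | does (colour v Fin.≟ a)
  ... | true  | _     = here refl
  ... | false | true  = there (here refl)
  ... | false | false = there (there (here refl))

  colour-pick : ∀ a {t} → Rainbow t → colour (pick a t) ≡ a
  colour-pick a {u , v , w} rainbow with colour u Fin.≟ a | colour v Fin.≟ a
  ... | yes eq | _      = eq
  ... | no _   | yes eq = eq
  ... | no u≢a | no v≢a = distinct-exhaust rainbow a u≢a v≢a

  colour-injective : ∀ {t} → Rainbow t → ∀ {x y} → x ∈ corners t → y ∈ corners t →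
                     colour x ≡ colour y → x ≡ y
  colour-injective (u≢v , v≢w , u≢w) = λ where
    (here refl)                 (here refl)                 _  → refl
    (here refl)                 (there (here refl))         eq → contradiction eq u≢v
    (here refl)                 (there (there (here refl))) eq → contradiction eq u≢w
    (there (here refl))         (here refl)                 eq → contradiction (sym eq) u≢v
    (there (here refl))         (there (here refl))         _  → refl
    (there (here refl))         (there (there (here refl))) eq → contradiction eq v≢w
    (there (there (here refl))) (here refl)                 eq → contradiction (sym eq) u≢w
    (there (there (here refl))) (there (here refl))         eq → contradiction (sym eq) v≢w
    (there (there (here refl))) (there (there (here refl))) _  → refl

  RainbowTriangle : Triple → Set
  RainbowTriangle t = Triangle G t × Rainbow t

  pick-adjacent : ∀ {a b t} → a ≢ b → RainbowTriangle t → Adj G (pick a t) (pick b t)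
  pick-adjacent {a} {b} {t} a≢b (triangle , rainbow) =
    corners-adjacent G triangle (pick∈corners a t) (pick∈corners b t)
      λ eq → a≢b (trans (sym (colour-pick a rainbow)) (trans (cong colour eq) (colour-pick b rainbow)))

  pick-shadow : ∀ {a b c t} → a ≢ b → a ≢ c → b ≢ c → RainbowTriangle t →
                IsShadow a b c (pick a t , pick b t)
  pick-shadow {a} {b} {c} {t} a≢b a≢c b≢c r@(_ , rainbow) =
    colour-pick a rainbow , colour-pick b rainbow , pick-adjacent a≢b r ,
    pick c t , colour-pick c rainbow , pick-adjacent (a≢c ∘ sym) r , pick-adjacent (b≢c ∘ sym) r

  -- In a rainbow triple a corner `x` is the one picked by its own colour, hence it is also picked
  -- from `t′`.
  pick-⊆ : ∀ {t t′} → Rainbow t → (∀ a → pick a t ≡ pick a t′) →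
           ∀ {x} → x ∈ corners t → x ∈ corners t′
  pick-⊆ {t} {t′} rainbow same {x} x∈ = subst (_∈ corners t′)
    (trans (sym (same (colour x)))
      (colour-injective rainbow (pick∈corners _ t) x∈ (colour-pick _ rainbow)))
    (pick∈corners (colour x) t′)

  pick-injective : ∀ {t t′} → RainbowTriangle t → RainbowTriangle t′ →
                   pick 0F t ≡ pick 0F t′ → pick 1F t ≡ pick 1F t′ → pick 2F t ≡ pick 2F t′ → t ≡ t′
  pick-injective {t} {t′} ((i , _) , r) ((i′ , _) , r′) e₀ e₁ e₂ =
    increasing-antisym i i′ (pick-⊆ r same) (pick-⊆ r′ (sym ∘ same))
    where
    same : ∀ a → pick a t ≡ pick a t′
    same 0F = e₀
    same 1F = e₁
    same 2F = e₂

  -- The left summand holds edges between colours 0 and 1, the right one edges between colours 0 and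
  -- 2.
  Key = (Fin n × Fin n) ⊎ (Fin n × Fin n)

  _≟ᴷ_ : DecidableEquality Key
  _≟ᴷ_ = Sum.≡-dec (≡-dec Fin._≟_ Fin._≟_) (≡-dec Fin._≟_ Fin._≟_)

  _∼_ : Key → Triple → Set
  inj₁ e ∼ t = (pick 0F t , pick 1F t) ≡ e
  inj₂ e ∼ t = (pick 0F t , pick 2F t) ≡ e

  _∼?_ : ∀ q t → Dec (q ∼ t)
  inj₁ e ∼? t = ≡-dec Fin._≟_ Fin._≟_ _ e
  inj₂ e ∼? t = ≡-dec Fin._≟_ Fin._≟_ _ e

  -- In the link of a vertex of colour 0, both sides have minimum degree above c.
  dense⇒cycle : ∀ {c L t} → Unique L → (∀ {t} → t ∈ L → RainbowTriangle t) →
                (∀ {t q} → t ∈ L → q ∼ t → c < degree _≟ᴷ_ _∼?_ q L) → t ∈ L →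
                C (suc (2 * suc c)) ⊑ G
  dense⇒cycle {c} {L} {t} L! rainbow dense t∈ =
    subst (λ ℓ → C (suc ℓ) ⊑ G) (trans (length-vertices z) (cong (2 *_) length-xs))
      (closePath G (lookup (vertices z)) u
        (lookup-injective (vertices-unique disjoint z))
        (λ {i} eq → irrefl G eq (linked (∈-lookup i)))
        (lookup-linked (vertices-linked edge (symm G ∘ edge) z))
        (λ {i} _ → linked (∈-lookup i))
        (λ {i} _ → linked (∈-lookup i)))
    where
    u = pick 0F t

    -- The link of `u` in the surviving triangles, directed from colour 1 to colour 2.
    E : Fin n → Fin n → Set
    E x y = ∃ λ t → t ∈ L × pick 0F t ≡ u × pick 1F t ≡ x × pick 2F t ≡ y

    -- More than `c` triangles of `L` have key `q` and they differ in their corner of colour `b`, so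
    -- one of these corners avoids `vs`.
    another : ∀ q b →
      (∀ {s s′} → s ∈ L → s′ ∈ L → q ∼ s → q ∼ s′ → pick b s ≡ pick b s′ → s ≡ s′) →
      ∀ {s} → s ∈ L → q ∼ s → ∀ vs → length vs ≤ c →
      ∃ λ s → s ∈ L × q ∼ s × pick b s ∉ vs
    another q b inj s∈ q∼s vs vs≤c =
      let s , s∈′ , fresh = injective⇒fresh (filter⁺ (q ∼?_) L!) (pick b)
            (λ s∈ s′∈ →
              let s∈L , q∼s = ∈-filter⁻ (q ∼?_) {xs = L} s∈
                  s′∈L , q∼s′ = ∈-filter⁻ (q ∼?_) {xs = L} s′∈
              in inj s∈L s′∈L q∼s q∼s′)
            Fin._≟_ vs (ℕ.≤-<-trans vs≤c (dense {q = q} s∈ q∼s))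
          s∈L , q∼s = ∈-filter⁻ (q ∼?_) {xs = L} s∈′
      in s , s∈L , q∼s , fresh

    growʳ : ∀ {x y} → E x y → ∀ ys → length ys ≤ c → ∃ λ y′ → y′ ∉ ys × E x y′
    growʳ {x} (s , s∈ , s₀ , s₁ , _) ys ys≤c
      = let s′ , s′∈ , k , fresh = another (inj₁ (u , x)) 2F
              (λ s∈ s′∈ k k′ → pick-injective (rainbow s∈) (rainbow s′∈)
                (cong proj₁ (trans k (sym k′))) (cong proj₂ (trans k (sym k′))))
              s∈ (cong₂ _,_ s₀ s₁) ys ys≤c
        in pick 2F s′ , fresh , s′ , s′∈ , cong proj₁ k , cong proj₂ k , refl

    growˡ : ∀ {x y} → E x y → ∀ xs → length xs ≤ c → ∃ λ x′ → x′ ∉ xs × E x′ y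
    growˡ {y = y} (s , s∈ , s₀ , _ , s₂) xs xs≤c
      = let s′ , s′∈ , k , fresh = another (inj₂ (u , y)) 1F
              (λ s∈ s′∈ k k′ eq → pick-injective (rainbow s∈) (rainbow s′∈)
                (cong proj₁ (trans k (sym k′))) eq (cong proj₂ (trans k (sym k′))))
              s∈ (cong₂ _,_ s₀ s₂) xs xs≤c
        in pick 1F s′ , fresh , s′ , s′∈ , cong proj₁ k , refl , cong proj₂ k

    edge : ∀ {x y} → E x y → Adj G x y
    edge (_ , s∈ , _ , refl , refl) = pick-adjacent (λ ()) (rainbow s∈)

    disjoint : ∀ {v x y} → E v y → ¬ E x v
    disjoint (s , s∈ , _ , refl , _) (s′ , s′∈ , _ , _ , eq)
      with trans (sym (colour-pick 2F (proj₂ (rainbow s′∈))))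
                 (trans (cong colour eq) (colour-pick 1F (proj₂ (rainbow s∈))))
    ... | ()

    -- The edge of `t` opposite `u` starts the path, and `j = c` gives it `2 * suc c` vertices, one
    -- fewer than the cycle closed through `u`.
    path = greedy growʳ growˡ (_ , _ , t , t∈ , refl , refl , refl) c ℕ.≤-refl
    z = proj₁ (proj₂ (proj₂ path))
    length-xs = proj₂ (proj₂ (proj₂ path))

    linked : ∀ {v} → v ∈ vertices z → Adj G u v
    linked v∈ with vertices⊆ z v∈
    ... | inj₁ p with s , s∈ , eq , refl , _ ← proj₂ (zigzag-left z p) =
      subst (λ u → Adj G u _) eq (pick-adjacent (λ ()) (rainbow s∈))
    ... | inj₂ p with s , s∈ , eq , _ , refl ← proj₂ (zigzag-right z p) =
      subst (λ u → Adj G u _) eq (pick-adjacent (λ ()) (rainbow s∈))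

  -- Peeling with threshold `c` must end with nothing, as a surviving triangle would give the
  -- forbidden cycle. So every triangle is charged to a key, at most `c` to each, and the keys form
  -- two shadows.
  length-rainbow≤ : ∀ c → 3 ≤ 2 * suc c → C (suc (2 * suc c)) -free G →
                    ∀ {L} → Unique L → (∀ {t} → t ∈ L → RainbowTriangle t) →
                    length L ≤ c * (2 * ex m m (C (2 * suc c)))
  length-rainbow≤ c 3≤ℓ free {L} L! rainbow = begin
    length L                                           ≤⟨ few ⟩
    c * length keys                                    ≡⟨ cong (c *_) length-keys ⟩
    c * (length (shadow 0F 1F 2F) + length (shadow 0F 2F 1F))
      ≤⟨ ℕ.*-monoʳ-≤ c (ℕ.+-mono-≤ (length-shadow≤ex (λ ()) (λ ()) (λ ()) 3≤ℓ free)
                                   (length-shadow≤ex (λ ()) (λ ()) (λ ()) 3≤ℓ free)) ⟩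
    c * (e + e)                                        ≡⟨ cong (λ f → c * (e + f)) (sym (ℕ.+-identityʳ e)) ⟩
    c * (2 * e)                                        ∎
    where
    open ℕ.≤-Reasoning
    e = ex m m (C (2 * suc c))

    keys : List Key
    keys = map inj₁ (shadow 0F 1F 2F) ++ map inj₂ (shadow 0F 2F 1F)

    length-keys : length keys ≡ length (shadow 0F 1F 2F) + length (shadow 0F 2F 1F)
    length-keys = trans (length-++ (map inj₁ (shadow 0F 1F 2F)))
      (cong₂ _+_ (length-map inj₁ (shadow 0F 1F 2F)) (length-map inj₂ (shadow 0F 2F 1F)))

    covers : ∀ {t q} → t ∈ L → q ∼ t → q ∈ keys
    covers {q = inj₁ _} t∈ refl =
      ∈-++⁺ˡ (∈-map⁺ inj₁ (∈-shadow (pick-shadow (λ ()) (λ ()) (λ ()) (rainbow t∈))))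
    covers {q = inj₂ _} t∈ refl =
      ∈-++⁺ʳ (map inj₁ (shadow 0F 1F 2F))
        (∈-map⁺ inj₂ (∈-shadow (pick-shadow (λ ()) (λ ()) (λ ()) (rainbow t∈))))

    few : length L ≤ c * length keys
    few with peel _≟ᴷ_ _∼?_ c keys L covers L!
    ... | []      , _   , _   , _     , bound = bound
    ... | (t ∷ _) , L′! , L′⊆ , dense , _     =
      contradiction (dense⇒cycle L′! (rainbow ∘ L′⊆) dense (here refl)) free

-- Groups of three and the final count

n≤3⌈n/3⌉ : ∀ n → n ≤ ⌈ n /3⌉ * 3
n≤3⌈n/3⌉ n = ℕ.+-cancelʳ-≤ 2 n (⌈ n /3⌉ * 3) (begin
  n + 2                         ≡⟨ m≡m%n+[m/n]*n (n + 2) 3 ⟩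
  (n + 2) % 3 + ⌈ n /3⌉ * 3     ≤⟨ ℕ.+-monoˡ-≤ (⌈ n /3⌉ * 3) (s≤s⁻¹ (m%n<n (n + 2) 3)) ⟩
  2 + ⌈ n /3⌉ * 3               ≡⟨ ℕ.+-comm 2 _ ⟩
  ⌈ n /3⌉ * 3 + 2               ∎)
  where open ℕ.≤-Reasoning

module _ {n : ℕ} (G : Graph (Fin n)) where

  private
    m = ⌈ n /3⌉

    -- Quotient and remainder by 3 serve as group and label; the vertices are first embedded into
    -- the `m * 3` available places.
    position : Fin n → Fin m × Fin 3
    position v = remQuot {m} 3 (inject≤ v (n≤3⌈n/3⌉ n))

    position-injective : ∀ {u v} → position u ≡ position v → u ≡ v
    position-injective {u} {v} eq = Fin.inject≤-injective _ _ u v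
      (trans (sym (Fin.combine-remQuot {m} 3 _))
        (trans (cong (λ (i , a) → combine i a) eq) (Fin.combine-remQuot {m} 3 _)))

  open Colouring (proj₁ ∘ position) (proj₂ ∘ position)
    (λ i a → position-injective (cong₂ _,_ i a))

  triangleList : List (Fin n × Fin n × Fin n)
  triangleList =
    filter (triangle? G) (cartesianProduct (allFin n) (cartesianProduct (allFin n) (allFin n)))

  isTriangle : ∀ {t} → t ∈ triangleList → Triangle G t
  isTriangle = proj₂ ∘ ∈-filter⁻ (triangle? G)
    {xs = cartesianProduct (allFin n) (cartesianProduct (allFin n) (allFin n))}

  triangleList-unique : Unique triangleList
  triangleList-unique = filter⁺ (triangle? G)
    (cartesianProduct⁺ (allFin⁺ n) (cartesianProduct⁺ (allFin⁺ n) (allFin⁺ n)))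

  manyRainbow : ∃ λ s → 2 * triangles G ≤ 9 * length (filter (rainbow? s) triangleList)
  -- The proportion 6/27 is 2/9, so the common factor cancelled is `3 * 3 ^ m`.
  manyRainbow = s , ℕ.*-cancelˡ-≤ (3 * 3 ^ m) ⦃ ℕ.m*n≢0 3 (3 ^ m) ⦃ _ ⦄ ⦃ ℕ.m^n≢0 3 m ⦄ ⦄ (begin
      3 * 3 ^ m * (2 * triangles G)
        ≡⟨ solve 2 (λ p T → con 3 :* p :* (con 2 :* T) := con 6 :* p :* T) refl (3 ^ m) (triangles G) ⟩
      6 * 3 ^ m * triangles G
        ≤⟨ total-filter {d = 27} rainbow? triangleList each ⟩
      27 * total m count
        ≤⟨ ℕ.*-monoʳ-≤ 27 (proj₂ (average≤max m count)) ⟩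
      27 * (3 ^ m * count s)
        ≡⟨ solve 2 (λ p T → con 27 :* (p :* T) := con 3 :* p :* (con 9 :* T)) refl (3 ^ m) (count s) ⟩
      3 * 3 ^ m * (9 * count s) ∎)
    where
    open ℕ.≤-Reasoning
    open +-*-Solver
    count = λ s → length (filter (rainbow? s) triangleList)
    s = proj₁ (average≤max m count)
    each : ∀ {t} → t ∈ triangleList → 6 * 3 ^ m ≤ 27 * total m (λ s → indicator (rainbow? s t))
    each {t} t∈ with (u<v , v<w) , _ ← isTriangle t∈ =
      rainbow-average (Fin.<⇒≢ u<v) (Fin.<⇒≢ v<w) (Fin.<⇒≢ (Fin.<-trans u<v v<w))

  -- The factor 9/2 lost by the colouring meets the factor 2 from the two kinds of keys, which
  -- leaves 9.
  triangles≤ : ∀ c → 3 ≤ 2 * suc c → C (suc (2 * suc c)) -free G →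
               triangles G ≤ 9 * c * ex m m (C (2 * suc c))
  triangles≤ c 3≤ℓ free = ℕ.*-cancelˡ-≤ 2 (begin
      2 * triangles G       ≤⟨ proj₂ manyRainbow ⟩
      9 * length L          ≤⟨ ℕ.*-monoʳ-≤ 9 (length-rainbow≤ c 3≤ℓ free (filter⁺ (rainbow? s) triangleList-unique)
                                 (λ t∈ → let t∈T , r = ∈-filter⁻ (rainbow? s) {xs = triangleList} t∈ in isTriangle t∈T , r)) ⟩
      9 * (c * (2 * e))     ≡⟨ solve 2 (λ c e → con 9 :* (c :* (con 2 :* e)) := con 2 :* (con 9 :* c :* e)) refl c e ⟩
      2 * (9 * c * e)       ∎)
    where
    open ℕ.≤-Reasoning
    open +-*-Solver
    s = proj₁ manyRainbow
    L = filter (rainbow? s) triangleList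
    e = ex m m (C (2 * suc c))
    open Rainbows G (colour s) (proj₁ ∘ position) (colour-group-injective s)

theorem1 : (k n : ℕ) → 2 ≤ k → 1 ≤ n →
    t (2 * k + 1) n ≤ 9 * (k ∸ 1) * ex ⌈ n /3⌉ ⌈ n /3⌉ (C (2 * k))
theorem1 (suc c) n 2≤k _ = begin
  t (2 * suc c + 1) n                               ≡⟨ sym attained ⟩
  triangles G                                       ≤⟨ triangles≤ G c 3≤ℓ
    (subst (λ ℓ → C ℓ -free G) (ℕ.+-comm (2 * suc c) 1) free) ⟩
  9 * c * ex ⌈ n /3⌉ ⌈ n /3⌉ (C (2 * suc c))        ∎
  where
  open ℕ.≤-Reasoning
  3≤ℓ : 3 ≤ 2 * suc c
  -- From `2 ≤ k` the even cycle has length at least 4.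
  3≤ℓ = ℕ.≤-trans (ℕ.n≤1+n 3) (ℕ.*-monoʳ-≤ 2 2≤k)
  extremal = proj₁ (t-isMaximum {2 * suc c + 1} (ℕ.≤-trans 3≤ℓ (ℕ.m≤m+n _ 1)) n)
  G = proj₁ extremal
  free = proj₁ (proj₂ extremal)
  attained = proj₂ (proj₂ extremal)
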